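{- Fix $n>k\ge0$. The number $b(n,k)$ of boolean intervals of rank $k$ in the middle order $\mathcal{P}_n$ is $$b(n,k)=\sum_{i=0}^{n}\binom{i}{k}\,c(n,n-i),$$ where $c(n,j)$ is the number of permutations of size $n$ having exactly $j$ cycles (signless Stirling number of the first kind).
   Context: For $w\in S_n$ (one-line notation), its inversion sequence is $I(w)=(x_1,\ldots,x_n)$ with $x_i=\#\{j<i : w^{ -1}(j)>w^{ -1}(i)\}$. The middle order $\mathcal{P}_n$ is the poset on $S_n$ with $v\le w$ iff $I(v)\le I(w)$ coordinate-wise; it is graded with rank of $w$ equal to the sum of entries of $I(w)$, and the rank of $[v,w]$ is $r(w)-r(v)$. An interval is boolean if it is isomorphic to a boolean algebra. -}

module Defs where

open import Data.Nat using (ℕ; zero; suc; _+_; _*_; _∸_; _≤_; _<_; _≤?_; _<?_)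
import Data.Nat as ℕ
open import Data.Fin using (Fin; toℕ)
import Data.Fin as F
open import Data.Fin.Properties using (all?)
open import Data.Fin.Subset using (Subset; _⊆_)
open import Data.Vec using (Vec; []; _∷_; lookup)
open import Data.List using (List; []; _∷_; [_]; length; filter; allFin; concatMap; map; upTo)
open import Data.Nat.ListAction using (sum)
open import Data.List.Membership.Propositional using (_∈_)
open import Data.List.Relation.Unary.Unique.Propositional using (Unique)
open import Data.Product using (Σ; ∃; _×_; _,_; proj₁)
open import Relation.Nullary using (Dec; yes; no)
open import Relation.Nullary.Decidable using (_×-dec_; _→-dec_)
open import Relation.Binary.PropositionalEquality using (_≡_)
open import Function.Bundles using (_⇔_)
open import Data.Nat.Combinatorics using (_C_)

-- A permutation of size n in one-line notation: w = (w(0), ..., w(n-1)),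
-- entries in Fin n, required to be injective (hence bijective).
Word : ℕ → Set
Word n = Vec (Fin n) n

IsPerm : ∀ {n} → Word n → Set
IsPerm {n} w = ∀ (i j : Fin n) → lookup w i ≡ lookup w j → i ≡ j

isPerm? : ∀ {n} (w : Word n) → Dec (IsPerm w)
isPerm? w = all? (λ i → all? (λ j → (lookup w i F.≟ lookup w j) →-dec (i F.≟ j)))

-- position of the value i in a word (= w⁻¹(i) when w is a permutation)
posOf : ∀ {n m} → Vec (Fin n) m → Fin n → ℕ
posOf [] i = 0
posOf (x ∷ xs) i with x F.≟ i
... | yes _ = 0
... | no _ = suc (posOf xs i)

invSeq : ∀ {n} → Word n → Fin n → ℕ
invSeq {n} w i =
  length (filter (λ j → (toℕ j <? toℕ i) ×-dec (posOf w i <? posOf w j)) (allFin n))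

_≤ₘ_ : ∀ {n} → Word n → Word n → Set
_≤ₘ_ {n} v w = ∀ (i : Fin n) → invSeq v i ≤ invSeq w i

rank : ∀ {n} → Word n → ℕ
rank {n} w = sum (map (invSeq w) (allFin n))

Interval : ∀ {n} → Word n → Word n → Set
Interval {n} v w = Σ (Word n) (λ u → IsPerm u × (v ≤ₘ u) × (u ≤ₘ w))

IsoToBoolean : ∀ {n} → Word n → Word n → ℕ → Set
IsoToBoolean {n} v w m =
  Σ (Interval v w → Subset m) λ f →
  Σ (Subset m → Interval v w) λ g →
    (∀ x → proj₁ (g (f x)) ≡ proj₁ x) ×
    (∀ s → f (g s) ≡ s) ×
    (∀ x y → (proj₁ x ≤ₘ proj₁ y) ⇔ (f x ⊆ f y))

IsBooleanIntervalOfRank : ∀ {n} → ℕ → Word n → Word n → Set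
IsBooleanIntervalOfRank k v w =
  IsPerm v × IsPerm w × (v ≤ₘ w) × (∃ λ m → IsoToBoolean v w m) × (rank w ∸ rank v ≡ k)

allWords : ∀ n m → List (Vec (Fin n) m)
allWords n zero = [ [] ]
allWords n (suc m) = concatMap (λ x → map (x ∷_) (allWords n m)) (allFin n)

iter : ∀ {n} → Word n → ℕ → Fin n → Fin n
iter w zero i = i
iter w (suc t) i = lookup w (iter w t i)

IsCycleMin : ∀ {n} → Word n → Fin n → Set
IsCycleMin {n} w i = ∀ (t : Fin n) → toℕ i ≤ toℕ (iter w (suc (toℕ t)) i)

isCycleMin? : ∀ {n} (w : Word n) (i : Fin n) → Dec (IsCycleMin w i)
isCycleMin? w i = all? (λ t → toℕ i ≤? toℕ (iter w (suc (toℕ t)) i))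

cycles : ∀ {n} → Word n → ℕ
cycles {n} w = length (filter (isCycleMin? w) (allFin n))

c : ℕ → ℕ → ℕ
c n j = length (filter (λ w → isPerm? w ×-dec (cycles w ℕ.≟ j)) (allWords n n))

rhs : ℕ → ℕ → ℕ
rhs n k = sum (map (λ i → (i C k) * c n (n ∸ i)) (upTo (suc n)))

NumBooleanIntervals : ℕ → ℕ → ℕ → Set
NumBooleanIntervals n k N =
  Σ (List (Word n × Word n)) λ L →
    Unique L ×
    (∀ v w → ((v , w) ∈ L) ⇔ IsBooleanIntervalOfRank k v w) ×
    length L ≡ N

{-# OPTIONS --safe #-}
module Submission where

-- The map w ↦ I(w) is an isomorphism from the middle order onto a product of chains of
-- sizes 1, ..., n. An interval in a product of chains is boolean exactly when no coordinate
-- grows by more than one: if some coordinate grew by two, changing it alone would give a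
-- chain v < b < w′ in which the complement of b relative to [v, w′] would be comparable
-- with b. Hence the boolean intervals of rank k with top w correspond to the k-subsets of
-- the nonzero entries of I(w). Inserting the elements 1, ..., n one after the other into
-- the cycle structure of a permutation, where the entry 0 opens a new cycle, shows that
-- the entry sequences with i nonzero entries are equinumerous with the permutations with
-- n - i cycles.

open import Defs
open import Data.Bool using (true; false)
open import Data.Empty using (⊥)
open import Data.Fin using (Fin; zero; suc; toℕ; fromℕ; inject₁)
import Data.Fin as F
import Data.Fin.Properties as Fₚ
open import Data.Fin.Relation.Unary.Top using (view; ‵fromℕ; ‵inject₁)
open import Data.Fin.Subset using (Subset; _∪_; _∩_; ∁)
import Data.Fin.Subset as S
import Data.Fin.Subset.Properties as Sₚ
open import Data.List using (List; []; _∷_; _++_; length; filter; allFin; concatMap; map; tabulate; upTo)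
open import Data.List.Membership.Propositional using (_∈_; find)
open import Data.List.Membership.Propositional.Properties
import Data.List.Properties as Lₚ
open import Data.List.Relation.Binary.Subset.Propositional using (_⊆_)
open import Data.List.Relation.Unary.All as All using ([]; _∷_)
open import Data.List.Relation.Unary.AllPairs using ([]; _∷_)
open import Data.List.Relation.Unary.Any using (here; there)
import Data.List.Relation.Unary.Any as Any
open import Data.List.Relation.Unary.Unique.Propositional using (Unique)
import Data.List.Relation.Unary.Unique.Propositional.Properties as Uₚ
open import Data.Nat using (ℕ; zero; suc; _+_; _*_; _∸_; _≤_; _<_; z≤n; s≤s; _<?_)
import Data.Nat as ℕ
open import Data.Nat.Combinatorics using (_C_; nCk+nC[k+1]≡[n+1]C[k+1])
open import Data.Nat.ListAction using (sum)
import Data.Nat.Properties as ℕₚ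
open import Data.Product using (Σ; ∃-syntax; _×_; _,_; proj₁; proj₂)
open import Data.Sum using (_⊎_; inj₁; inj₂)
open import Data.Vec using (Vec; []; _∷_; lookup; _∷ʳ_; _[_]≔_)
import Data.Vec as V
import Data.Vec.Properties as Vₚ
open import Function using (_∘_; id; case_of_)
open import Function.Bundles using (mk⇔; module Equivalence)
open import Relation.Binary.Definitions using (tri<; tri≈; tri>)
open import Relation.Binary.PropositionalEquality
open import Relation.Nullary using (Dec; yes; no; ¬_; contradiction)
open import Relation.Nullary.Decidable using (_×-dec_; does; dec-true; dec-false)

private variable
  A B : Set

-- Counting with duplicate-free lists

-- The occurrence that the membership proof points to is cut out, so the length drops by exactly
-- one. Further copies of `x` may survive in `zs`.
delete : ∀ {x : A} {ys} → x ∈ ys →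
         ∃[ zs ] length ys ≡ suc (length zs) × (∀ {y} → y ∈ ys → y ≡ x ⊎ y ∈ zs)
delete {ys = y ∷ ys} (here refl) =
  ys , refl , λ { (here p) → inj₁ p ; (there p) → inj₂ p }
delete {ys = y ∷ ys} (there x∈) with delete x∈
... | zs , eq , split = y ∷ zs , cong suc eq , split′
  where
  split′ : ∀ {z} → z ∈ y ∷ ys → _ ⊎ z ∈ y ∷ zs
  split′ (here p) = inj₂ (here p)
  split′ (there p) with split p
  ... | inj₁ q = inj₁ q
  ... | inj₂ q = inj₂ (there q)

tail-⊆ : ∀ {x : A} {xs ys zs} → Unique (x ∷ xs) → x ∷ xs ⊆ ys →
         (∀ {y} → y ∈ ys → y ≡ x ⊎ y ∈ zs) → xs ⊆ zs
tail-⊆ u sub split p with split (sub (there p))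
... | inj₁ refl = contradiction p (Uₚ.Unique[x∷xs]⇒x∉xs u)
... | inj₂ q = q

-- Pigeonhole principle: each member of `xs` crosses out an occurrence of its own in `ys`.
unique-⊆⇒length≤ : ∀ {xs ys : List A} → Unique xs → xs ⊆ ys → length xs ≤ length ys
unique-⊆⇒length≤ {xs = []} u sub = z≤n
unique-⊆⇒length≤ {xs = x ∷ xs} u@(_ ∷ u′) sub with delete (sub (here refl))
... | zs , eq , split =
  subst (suc (length xs) ≤_) (sym eq) (s≤s (unique-⊆⇒length≤ u′ (tail-⊆ u sub split)))

-- When every member of `xs` has crossed out its occurrence, the lengths leave nothing over in `ys`.
-- This is what later turns injections between sets of equal size into bijections.
unique-⊆-length≥⇒⊇ : ∀ {xs ys : List A} → Unique xs → xs ⊆ ys → length ys ≤ length xs → ys ⊆ xs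
unique-⊆-length≥⇒⊇ {xs = []} {[]} u sub le ()
unique-⊆-length≥⇒⊇ {xs = x ∷ xs} {ys} u@(_ ∷ u′) sub le {y} y∈ with delete (sub (here refl))
... | zs , eq , split with split y∈
...   | inj₁ refl = here refl
...   | inj₂ q = there (unique-⊆-length≥⇒⊇ u′ (tail-⊆ u sub split)
                          (ℕₚ.≤-pred (subst (_≤ suc (length xs)) eq le)) q)

unique-⊆⊇⇒length≡ : ∀ {xs ys : List A} → Unique xs → Unique ys → xs ⊆ ys → ys ⊆ xs →
                    length xs ≡ length ys
unique-⊆⊇⇒length≡ u v p q = ℕₚ.≤-antisym (unique-⊆⇒length≤ u p) (unique-⊆⇒length≤ v q)

concatMap-∈⁺ : ∀ {f : A → List B} {x y xs} → x ∈ xs → y ∈ f x → y ∈ concatMap f xs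
concatMap-∈⁺ {f = f} x∈ y∈ = ∈-concatMap⁺ f (Any.map (λ { refl → y∈ }) x∈)

concatMap-∈⁻ : ∀ {f : A → List B} {y} xs → y ∈ concatMap f xs → ∃[ x ] x ∈ xs × y ∈ f x
concatMap-∈⁻ {f = f} xs y∈ = find (∈-concatMap⁻ f y∈)

-- The last hypothesis says that an element determines its block, so different blocks are disjoint.
concatMap-unique : ∀ {f : A → List B} {xs} → Unique xs → (∀ x → Unique (f x)) →
                   (∀ {x x′ y} → y ∈ f x → y ∈ f x′ → x ≡ x′) → Unique (concatMap f xs)
concatMap-unique {xs = []} _ _ _ = []
concatMap-unique {f = f} {xs = x ∷ xs} u@(_ ∷ u′) uf disj =
  Uₚ.++⁺ (uf x) (concatMap-unique u′ uf disj) λ { (p , q) →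
    case concatMap-∈⁻ xs q of λ { (x′ , x′∈ , r) →
      Uₚ.Unique[x∷xs]⇒x∉xs u (subst (_∈ xs) (sym (disj p r)) x′∈) } }

-- Enumerations of words and codes

allWords-complete : ∀ n m (w : Vec (Fin n) m) → w ∈ allWords n m
allWords-complete n zero [] = here refl
allWords-complete n (suc m) (x ∷ w) =
  concatMap-∈⁺ (∈-allFin x) (∈-map⁺ (x ∷_) (allWords-complete n m w))

allWords-unique : ∀ n m → Unique (allWords n m)
allWords-unique n zero = [] ∷ []
allWords-unique n (suc m) =
  concatMap-unique (Uₚ.allFin⁺ n) (λ x → Uₚ.map⁺ Vₚ.∷-injectiveʳ (allWords-unique n m))
    λ p q → case ∈-map⁻ _ p , ∈-map⁻ _ q of λ { ((_ , _ , refl) , (_ , _ , eq)) → Vₚ.∷-injectiveˡ eq }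

-- The head is the entry of the largest element (the last one of an inversion sequence).
data Code : ℕ → Set where
  []  : Code 0
  _∷_ : ∀ {n} → Fin (suc n) → Code n → Code (suc n)

∷-injˡ : ∀ {n} {x y : Fin (suc n)} {c d : Code n} → x Code.∷ c ≡ y ∷ d → x ≡ y
∷-injˡ refl = refl

∷-injʳ : ∀ {n} {x y : Fin (suc n)} {c d : Code n} → x Code.∷ c ≡ y ∷ d → c ≡ d
∷-injʳ refl = refl

allCodes : ∀ n → List (Code n)
allCodes zero = [] ∷ []
allCodes (suc n) = concatMap (λ x → map (x ∷_) (allCodes n)) (allFin (suc n))

allCodes-complete : ∀ {n} (c : Code n) → c ∈ allCodes n
allCodes-complete [] = here refl
allCodes-complete (x ∷ c) = concatMap-∈⁺ (∈-allFin x) (∈-map⁺ (x ∷_) (allCodes-complete c))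

allCodes-unique : ∀ n → Unique (allCodes n)
allCodes-unique zero = [] ∷ []
allCodes-unique (suc n) =
  concatMap-unique (Uₚ.allFin⁺ (suc n)) (λ x → Uₚ.map⁺ ∷-injʳ (allCodes-unique n))
    λ p q → case ∈-map⁻ _ p , ∈-map⁻ _ q of λ { ((_ , _ , refl) , (_ , _ , eq)) → ∷-injˡ eq }

nonzeros : ∀ {n} → Code n → ℕ
nonzeros [] = 0
nonzeros (zero ∷ c) = nonzeros c
nonzeros (suc _ ∷ c) = suc (nonzeros c)

nonzeros≤ : ∀ {n} (c : Code n) → nonzeros c ≤ n
nonzeros≤ [] = z≤n
nonzeros≤ (zero ∷ c) = ℕₚ.m≤n⇒m≤1+n (nonzeros≤ c)
nonzeros≤ (suc _ ∷ c) = s≤s (nonzeros≤ c)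

-- Cycles

lookup-∷ʳ-inject₁ : ∀ {n} (xs : Vec A n) y i → lookup (xs ∷ʳ y) (inject₁ i) ≡ lookup xs i
lookup-∷ʳ-inject₁ (x ∷ xs) y zero = refl
lookup-∷ʳ-inject₁ (x ∷ xs) y (suc i) = lookup-∷ʳ-inject₁ xs y i

lookup-∷ʳ-fromℕ : ∀ {n} (xs : Vec A n) y → lookup (xs ∷ʳ y) (fromℕ n) ≡ y
lookup-∷ʳ-fromℕ [] y = refl
lookup-∷ʳ-fromℕ (x ∷ xs) y = lookup-∷ʳ-fromℕ xs y

lookup-injective : ∀ {n} {xs ys : Vec A n} → (∀ i → lookup xs i ≡ lookup ys i) → xs ≡ ys
lookup-injective {xs = []} {[]} eq = refl
lookup-injective {xs = x ∷ xs} {y ∷ ys} eq = cong₂ _∷_ (eq zero) (lookup-injective (eq ∘ suc))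

-- zero makes the new largest element a fixed point; suc i puts it right after i in the cycle of i.
insertMax : ∀ {n} → Fin (suc n) → Word n → Word (suc n)
insertMax {n} zero w = V.map inject₁ w ∷ʳ fromℕ n
insertMax {n} (suc i) w = (V.map inject₁ w [ i ]≔ fromℕ n) ∷ʳ inject₁ (lookup w i)

module _ {n} (w : Word n) where

  fixed-inject₁ : ∀ p → lookup (insertMax zero w) (inject₁ p) ≡ inject₁ (lookup w p)
  fixed-inject₁ p = trans (lookup-∷ʳ-inject₁ (V.map inject₁ w) _ p) (Vₚ.lookup-map p inject₁ w)

  fixed-fromℕ : lookup (insertMax zero w) (fromℕ n) ≡ fromℕ n
  fixed-fromℕ = lookup-∷ʳ-fromℕ (V.map inject₁ w) _

  after-same : ∀ i → lookup (insertMax (suc i) w) (inject₁ i) ≡ fromℕ n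
  after-same i = trans (lookup-∷ʳ-inject₁ (V.map inject₁ w [ i ]≔ fromℕ n) _ i)
                       (Vₚ.lookup∘updateAt i (V.map inject₁ w))

  after-other : ∀ {i p} → p ≢ i → lookup (insertMax (suc i) w) (inject₁ p) ≡ inject₁ (lookup w p)
  after-other {i} {p} p≢i = trans (lookup-∷ʳ-inject₁ (V.map inject₁ w [ i ]≔ fromℕ n) _ p)
    (trans (Vₚ.lookup∘updateAt′ p i p≢i (V.map inject₁ w)) (Vₚ.lookup-map p inject₁ w))

  after-fromℕ : ∀ i → lookup (insertMax (suc i) w) (fromℕ n) ≡ inject₁ (lookup w i)
  after-fromℕ i = lookup-∷ʳ-fromℕ (V.map inject₁ w [ i ]≔ fromℕ n) _

  -- For `suc k`, the value `k` is sent to the new maximum and the maximum to the old image of `k`;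
  -- all other images are kept. A collision among old images would already be one in `w`.
  insertMax-perm : IsPerm w → ∀ x → IsPerm (insertMax x w)
  insertMax-perm pw zero p q eq with view p | view q
  ... | ‵fromℕ | ‵fromℕ = refl
  ... | ‵fromℕ | ‵inject₁ j =
    contradiction (trans (sym fixed-fromℕ) (trans eq (fixed-inject₁ j))) Fₚ.fromℕ≢inject₁
  ... | ‵inject₁ i | ‵fromℕ =
    contradiction (trans (sym fixed-fromℕ) (trans (sym eq) (fixed-inject₁ i))) Fₚ.fromℕ≢inject₁
  ... | ‵inject₁ i | ‵inject₁ j =
    cong inject₁ (pw i j (Fₚ.inject₁-injective
      (trans (sym (fixed-inject₁ i)) (trans eq (fixed-inject₁ j)))))
  insertMax-perm pw (suc k) = inj
    where
    w′ = insertMax (suc k) w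

    fromℕ-inject₁ : ∀ j → lookup w′ (fromℕ n) ≢ lookup w′ (inject₁ j)
    fromℕ-inject₁ j eq with j F.≟ k
    ... | yes refl = Fₚ.fromℕ≢inject₁ (sym (trans (sym (after-fromℕ k)) (trans eq (after-same k))))
    ... | no j≢k = j≢k (sym (pw k j (Fₚ.inject₁-injective
                     (trans (sym (after-fromℕ k)) (trans eq (after-other j≢k))))))

    inj : IsPerm w′
    inj p q eq with view p | view q
    ... | ‵fromℕ | ‵fromℕ = refl
    ... | ‵fromℕ | ‵inject₁ j = contradiction eq (fromℕ-inject₁ j)
    ... | ‵inject₁ i | ‵fromℕ = contradiction (sym eq) (fromℕ-inject₁ i)
    ... | ‵inject₁ i | ‵inject₁ j with i F.≟ k | j F.≟ k
    ...   | yes refl | yes refl = refl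
    ...   | yes refl | no j≢k =
      contradiction (trans (sym (after-same k)) (trans eq (after-other j≢k))) Fₚ.fromℕ≢inject₁
    ...   | no i≢k | yes refl =
      contradiction (trans (sym (after-same k)) (trans (sym eq) (after-other i≢k))) Fₚ.fromℕ≢inject₁
    ...   | no i≢k | no j≢k =
      cong inject₁ (pw i j (Fₚ.inject₁-injective
        (trans (sym (after-other i≢k)) (trans eq (after-other j≢k)))))

-- Everything can be read off the new word: the image of the maximum separates `zero` from `suc`,
-- the element sent to the maximum is `i`, and the old image of `i` is now the image of the maximum.
insertMax-injective : ∀ {n} x y {v w : Word n} → insertMax x v ≡ insertMax y w → x ≡ y × v ≡ w
insertMax-injective zero zero {v} {w} eq = refl , lookup-injective λ p →
  Fₚ.inject₁-injective (trans (sym (fixed-inject₁ v p))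
    (trans (cong (λ u → lookup u (inject₁ p)) eq) (fixed-inject₁ w p)))
insertMax-injective {n} zero (suc j) {v} {w} eq = contradiction
  (trans (sym (fixed-fromℕ v)) (trans (cong (λ u → lookup u (fromℕ n)) eq) (after-fromℕ w j)))
  Fₚ.fromℕ≢inject₁
insertMax-injective {n} (suc i) zero {v} {w} eq = contradiction
  (trans (sym (fixed-fromℕ w)) (trans (cong (λ u → lookup u (fromℕ n)) (sym eq)) (after-fromℕ v i)))
  Fₚ.fromℕ≢inject₁
insertMax-injective {n} (suc i) (suc j) {v} {w} eq with i F.≟ j
... | no i≢j = contradiction
  (trans (sym (after-same v i))
    (trans (cong (λ u → lookup u (inject₁ i)) eq) (after-other w i≢j)))
  Fₚ.fromℕ≢inject₁
... | yes refl = refl , lookup-injective same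
  where
  same : ∀ p → lookup v p ≡ lookup w p
  same p with p F.≟ i
  ... | yes refl = Fₚ.inject₁-injective (trans (sym (after-fromℕ v i))
          (trans (cong (λ u → lookup u (fromℕ n)) eq) (after-fromℕ w i)))
  ... | no p≢i = Fₚ.inject₁-injective (trans (sym (after-other v p≢i))
          (trans (cong (λ u → lookup u (inject₁ p)) eq) (after-other w p≢i)))

cyclePerm : ∀ {n} → Code n → Word n
cyclePerm [] = []
cyclePerm (x ∷ c) = insertMax x (cyclePerm c)

cyclePerm-perm : ∀ {n} (c : Code n) → IsPerm (cyclePerm c)
cyclePerm-perm [] ()
cyclePerm-perm (x ∷ c) = insertMax-perm (cyclePerm c) (cyclePerm-perm c) x

cyclePerm-injective : ∀ {n} {c d : Code n} → cyclePerm c ≡ cyclePerm d → c ≡ d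
cyclePerm-injective {c = []} {[]} eq = refl
cyclePerm-injective {c = x ∷ c} {y ∷ d} eq with insertMax-injective x y eq
... | refl , eq′ = cong (x ∷_) (cyclePerm-injective eq′)

-- `IsCycleMin` tests n iterates only, which makes it decidable. Insertion changes the number of
-- steps between two points of a cycle, so the arguments about insertion use unbounded time.
OrbitMin : ∀ {n} → Word n → Fin n → Set
OrbitMin w i = ∀ t → toℕ i ≤ toℕ (iter w t i)

iter-injective : ∀ {n} {w : Word n} → IsPerm w → ∀ t {i j} → iter w t i ≡ iter w t j → i ≡ j
iter-injective pw zero eq = eq
iter-injective {w = w} pw (suc t) eq = iter-injective {w = w} pw t (pw _ _ eq)

iter-+ : ∀ {n} (w : Word n) s t i → iter w (s + t) i ≡ iter w s (iter w t i)
iter-+ w zero t i = refl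
iter-+ w (suc s) t i = cong (lookup w) (iter-+ w s t i)

-- Among the n + 1 iterates at times 0, ..., n two coincide, and the steps common to both can be
-- cancelled.
period : ∀ {n} {w : Word n} → IsPerm w → ∀ i → ∃[ p ] p < n × iter w (suc p) i ≡ i
period {n} {w} pw i with Fₚ.pigeonhole (ℕₚ.n<1+n n) (λ (s : Fin (suc n)) → iter w (toℕ s) i)
... | s , t , s<t , eq with ℕₚ.m≤n⇒∃[o]m+o≡n s<t
...   | p , 1+s+p≡t = p , ℕₚ.≤-trans (ℕₚ.m≤n+m (suc p) (toℕ s)) (subst (_≤ n) (sym s+1+p≡t) (ℕₚ.≤-pred (Fₚ.toℕ<n t)))
  , sym (iter-injective {w = w} pw (toℕ s) (trans eq (trans (cong (λ m → iter w m i) (sym s+1+p≡t))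
      (iter-+ w (toℕ s) (suc p) i))))
  where
  s+1+p≡t : toℕ s + suc p ≡ toℕ t
  s+1+p≡t = trans (ℕₚ.+-suc (toℕ s) p) 1+s+p≡t

iter-reduce : ∀ {n} {w : Word n} → IsPerm w → ∀ i t → ∃[ s ] s < n × iter w t i ≡ iter w s i
iter-reduce {n} {w} pw i t with period {w = w} pw i
... | p , p<n , per with go t
  where
  go : ∀ t → ∃[ s ] s ≤ p × iter w t i ≡ iter w s i
  go zero = 0 , z≤n , refl
  go (suc t) with go t
  ... | s , s≤p , eq with s ℕ.≟ p
  -- The period is `suc p`, so the step after time `p` closes the cycle and the clock restarts at 0.
  ...   | yes refl = 0 , z≤n , trans (cong (lookup w) eq) per
  ...   | no s≢p = suc s , ℕₚ.≤∧≢⇒< s≤p s≢p , cong (lookup w) eq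
... | s , s≤p , eq = s , ℕₚ.≤-<-trans s≤p p<n , eq

cycleMin⇒orbitMin : ∀ {n} {w : Word n} → IsPerm w → ∀ {i} → IsCycleMin w i → OrbitMin w i
cycleMin⇒orbitMin {w = w} pw {i} m t with iter-reduce {w = w} pw i t
... | zero , _ , eq = ℕₚ.≤-reflexive (cong toℕ (sym eq))
-- `IsCycleMin` at index `s` speaks of iterate `suc s`, so the bound on `suc s` is more than enough.
... | suc s , s<n , eq rewrite eq = subst (λ k → toℕ i ≤ toℕ (iter w (suc k) i))
        (Fₚ.toℕ-fromℕ< (ℕₚ.<-trans (ℕₚ.n<1+n s) s<n)) (m (F.fromℕ< (ℕₚ.<-trans (ℕₚ.n<1+n s) s<n)))

orbitMin⇒cycleMin : ∀ {n} {w : Word n} {i} → OrbitMin w i → IsCycleMin w i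
orbitMin⇒cycleMin m t = m (suc (toℕ t))

-- An old step either survives or becomes a detour of two steps through the new maximum; this is all
-- that the comparison of orbits uses.
insertMax-step : ∀ {n} (w : Word n) x q → let w′ = insertMax x w in
  lookup w′ (inject₁ q) ≡ inject₁ (lookup w q) ⊎
  (lookup w′ (inject₁ q) ≡ fromℕ n × lookup w′ (fromℕ n) ≡ inject₁ (lookup w q))
insertMax-step w zero q = inj₁ (fixed-inject₁ w q)
insertMax-step w (suc i) q with q F.≟ i
... | yes refl = inj₂ (after-same w q , after-fromℕ w q)
... | no q≢i = inj₁ (after-other w q≢i)

module _ {n} (w : Word n) (x : Fin (suc n)) where
  private w′ = insertMax x w

  iter-old⇒new : ∀ p t → ∃[ s ] iter w′ s (inject₁ p) ≡ inject₁ (iter w t p)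
  iter-old⇒new p zero = 0 , refl
  iter-old⇒new p (suc t) with iter-old⇒new p t | insertMax-step w x (iter w t p)
  ... | s , eq | inj₁ e = suc s , trans (cong (lookup w′) eq) e
  ... | s , eq | inj₂ (e , e′) =
    suc (suc s) , trans (cong (lookup w′) (trans (cong (lookup w′) eq) e)) e′

  -- The second alternative also records where the walk goes after the maximum. Without it the
  -- induction would lose the old orbit during the detour.
  iter-new⇒old : ∀ p s → (∃[ t ] iter w′ s (inject₁ p) ≡ inject₁ (iter w t p)) ⊎
    (iter w′ s (inject₁ p) ≡ fromℕ n × ∃[ t ] lookup w′ (fromℕ n) ≡ inject₁ (iter w t p))
  iter-new⇒old p zero = inj₁ (0 , refl)
  iter-new⇒old p (suc s) with iter-new⇒old p s
  ... | inj₂ (eq , t , e) = inj₁ (t , trans (cong (lookup w′) eq) e)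
  ... | inj₁ (t , eq) with insertMax-step w x (iter w t p)
  ...   | inj₁ e = inj₁ (suc t , trans (cong (lookup w′) eq) e)
  ...   | inj₂ (e , e′) = inj₂ (trans (cong (lookup w′) eq) e , suc t , e′)

  -- Besides old iterates the new orbit can only visit the maximum, which is never below `p`.
  orbitMin-old⇒new : ∀ {p} → OrbitMin w p → OrbitMin w′ (inject₁ p)
  orbitMin-old⇒new {p} m s with iter-new⇒old p s
  ... | inj₁ (t , eq) rewrite eq | Fₚ.toℕ-inject₁ p | Fₚ.toℕ-inject₁ (iter w t p) = m t
  ... | inj₂ (eq , _) rewrite eq = Fₚ.≤fromℕ (inject₁ p)

  orbitMin-new⇒old : ∀ {p} → OrbitMin w′ (inject₁ p) → OrbitMin w p
  orbitMin-new⇒old {p} m t with iter-old⇒new p t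
  ... | s , eq = subst₂ _≤_ (Fₚ.toℕ-inject₁ p)
                  (trans (cong toℕ eq) (Fₚ.toℕ-inject₁ (iter w t p))) (m s)

orbitMin-fixed : ∀ {n} (w : Word n) → OrbitMin (insertMax zero w) (fromℕ n)
orbitMin-fixed {n} w t = ℕₚ.≤-reflexive (cong toℕ (sym (fix t)))
  where
  fix : ∀ t → iter (insertMax zero w) t (fromℕ n) ≡ fromℕ n
  fix zero = refl
  fix (suc t) = trans (cong (lookup (insertMax zero w)) (fix t)) (fixed-fromℕ w)

-- One step away from the maximum lies an older, hence smaller, element.
¬orbitMin-after : ∀ {n} (w : Word n) i → ¬ OrbitMin (insertMax (suc i) w) (fromℕ n)
¬orbitMin-after {n} w i m = ℕₚ.<⇒≱
  (subst₂ _<_ (sym (trans (cong toℕ (after-fromℕ w i)) (Fₚ.toℕ-inject₁ _))) (sym (Fₚ.toℕ-fromℕ n))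
    (Fₚ.toℕ<n (lookup w i))) (m 1)

minima : ∀ {n} → Word n → List (Fin n)
minima {n} w = filter (isCycleMin? w) (allFin n)

minima-unique : ∀ {n} (w : Word n) → Unique (minima w)
minima-unique {n} w = Uₚ.filter⁺ (isCycleMin? w) (Uₚ.allFin⁺ n)

module _ {n} (w : Word n) (pw : IsPerm w) where
  private
    pw′ : ∀ x → IsPerm (insertMax x w)
    pw′ = insertMax-perm w pw

  old∈ : ∀ x {i} → i ∈ map inject₁ (minima w) → i ∈ minima (insertMax x w)
  old∈ x i∈ with ∈-map⁻ inject₁ i∈
  ... | p , p∈ , refl = ∈-filter⁺ (isCycleMin? (insertMax x w)) (∈-allFin _)
    (orbitMin⇒cycleMin (orbitMin-old⇒new w x
      (cycleMin⇒orbitMin pw (proj₂ (∈-filter⁻ (isCycleMin? w) {xs = allFin n} p∈)))))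

  ∈old : ∀ x {p} → IsCycleMin (insertMax x w) (inject₁ p) → inject₁ p ∈ map inject₁ (minima w)
  ∈old x m = ∈-map⁺ inject₁ (∈-filter⁺ (isCycleMin? w) (∈-allFin _)
    (orbitMin⇒cycleMin (orbitMin-new⇒old w x (cycleMin⇒orbitMin (pw′ x) m))))

  map-unique : Unique (map inject₁ (minima w))
  map-unique = Uₚ.map⁺ Fₚ.inject₁-injective (minima-unique w)

  -- Cycles are counted by their minima. Insertion neither creates nor destroys minima among the old
  -- elements, so only the status of the new element matters, and a fixed point is its own minimum.
  cycles-fixed : cycles (insertMax zero w) ≡ suc (cycles w)
  cycles-fixed = trans
    (unique-⊆⊇⇒length≡ (minima-unique (insertMax zero w))
      (All.tabulate (λ i∈ → λ { refl → case ∈-map⁻ inject₁ i∈ of λ { (_ , _ , e) → Fₚ.fromℕ≢inject₁ e } })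
        ∷ map-unique)
      to from)
    (cong suc (Lₚ.length-map inject₁ (minima w)))
    where
    to : minima (insertMax zero w) ⊆ fromℕ n ∷ map inject₁ (minima w)
    to {i} i∈ with view i
    ... | ‵fromℕ = here refl
    ... | ‵inject₁ p = there (∈old zero (proj₂ (∈-filter⁻ (isCycleMin? (insertMax zero w)) {xs = allFin (suc n)} i∈)))
    from : fromℕ n ∷ map inject₁ (minima w) ⊆ minima (insertMax zero w)
    from (here refl) = ∈-filter⁺ (isCycleMin? (insertMax zero w)) (∈-allFin _)
                         (orbitMin⇒cycleMin (orbitMin-fixed w))
    from (there i∈) = old∈ zero i∈

  cycles-after : ∀ i → cycles (insertMax (suc i) w) ≡ cycles w
  cycles-after k = trans
    (unique-⊆⊇⇒length≡ (minima-unique (insertMax (suc k) w)) map-unique to (old∈ (suc k)))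
    (Lₚ.length-map inject₁ (minima w))
    where
    to : minima (insertMax (suc k) w) ⊆ map inject₁ (minima w)
    to {i} i∈ with view i | ∈-filter⁻ (isCycleMin? (insertMax (suc k) w)) {xs = allFin (suc n)} i∈
    ... | ‵fromℕ | _ , m = contradiction (cycleMin⇒orbitMin (pw′ (suc k)) m) (¬orbitMin-after w k)
    ... | ‵inject₁ p | _ , m = ∈old (suc k) m

-- Each entry raises exactly one of the two summands by one: a zero opens a cycle, any other entry
-- extends one.
cycles+nonzeros : ∀ {n} (c : Code n) → cycles (cyclePerm c) + nonzeros c ≡ n
cycles+nonzeros [] = refl
cycles+nonzeros (zero ∷ c) =
  trans (cong (_+ nonzeros c) (cycles-fixed (cyclePerm c) (cyclePerm-perm c))) (cong suc (cycles+nonzeros c))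
cycles+nonzeros (suc i ∷ c) =
  trans (cong (_+ suc (nonzeros c)) (cycles-after (cyclePerm c) (cyclePerm-perm c) i))
    (trans (ℕₚ.+-suc _ _) (cong suc (cycles+nonzeros c)))

-- Inversion sequences

posOf-lookup : ∀ {n m} (xs : Vec (Fin n) m) → (∀ i j → lookup xs i ≡ lookup xs j → i ≡ j) →
               ∀ p → posOf xs (lookup xs p) ≡ toℕ p
posOf-lookup (x ∷ xs) inj zero with x F.≟ x
... | yes _ = refl
... | no x≢x = contradiction refl x≢x
posOf-lookup (x ∷ xs) inj (suc p) with x F.≟ lookup xs p
... | yes eq = contradiction (inj zero (suc p) eq) Fₚ.0≢1+n
... | no _ = cong suc (posOf-lookup xs (λ i j eq → Fₚ.suc-injective (inj (suc i) (suc j) eq)) p)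

-- A missed value together with the n distinct entries of `w` would give n + 1 distinct elements of
-- `Fin n`.
perm-surjective : ∀ {n} (w : Word n) → IsPerm w → ∀ a → ∃[ p ] lookup w p ≡ a
perm-surjective {n} w pw a with Fₚ.any? (λ p → lookup w p F.≟ a)
... | yes found = found
... | no missing = contradiction
  (unique-⊆⇒length≤ {xs = a ∷ map (lookup w) (allFin n)} {allFin n}
    (All.tabulate (λ b∈ eq → case ∈-map⁻ (lookup w) b∈ of λ { (p , _ , e) → missing (p , sym (trans eq e)) })
      ∷ Uₚ.map⁺ (pw _ _) (Uₚ.allFin⁺ n))
    (λ _ → ∈-allFin _))
  (ℕₚ.<⇒≱ (s≤s (ℕₚ.≤-reflexive (sym (Lₚ.length-map (lookup w) (allFin n))))))

posOf-injective : ∀ {n} (w : Word n) → IsPerm w → ∀ {a b} → posOf w a ≡ posOf w b → a ≡ b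
posOf-injective w pw {a} {b} eq with perm-surjective w pw a | perm-surjective w pw b
... | p , refl | q , refl = cong (lookup w) (Fₚ.toℕ-injective
  (trans (sym (posOf-lookup w pw p)) (trans eq (posOf-lookup w pw q))))

strictMono⇒≤ : ∀ {n} (f : Fin n → ℕ) → (∀ {p q} → toℕ p < toℕ q → f p < f q) → ∀ p → toℕ p ≤ f p
strictMono⇒≤ f mono zero = z≤n
strictMono⇒≤ f mono (suc p) = ℕₚ.≤-<-trans
  (strictMono⇒≤ (f ∘ inject₁)
    (λ {q} {r} q<r → mono (subst₂ _<_ (sym (Fₚ.toℕ-inject₁ q)) (sym (Fₚ.toℕ-inject₁ r)) q<r)) p)
  (mono (s≤s (ℕₚ.≤-reflexive (Fₚ.toℕ-inject₁ p))))

-- invSeq w a is, definitionally, the length of rightOf w a a.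
rightOf? : ∀ {n} (w : Word n) (a b j : Fin n) → Dec (toℕ j < toℕ a × posOf w b < posOf w j)
rightOf? w a b j = (toℕ j <? toℕ a) ×-dec (posOf w b <? posOf w j)

rightOf : ∀ {n} → Word n → Fin n → Fin n → List (Fin n)
rightOf {n} w a b = filter (rightOf? w a b) (allFin n)

∈-rightOf⁺ : ∀ {n} (w : Word n) {a b j} → toℕ j < toℕ a → posOf w b < posOf w j → j ∈ rightOf w a b
∈-rightOf⁺ w {a} {b} j<a b<j = ∈-filter⁺ (rightOf? w a b) (∈-allFin _) (j<a , b<j)

∈-rightOf⁻ : ∀ {n} (w : Word n) {a b j} → j ∈ rightOf w a b → toℕ j < toℕ a × posOf w b < posOf w j
∈-rightOf⁻ {n} w {a} {b} j∈ = proj₂ (∈-filter⁻ (rightOf? w a b) {xs = allFin n} j∈)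

rightOf-unique : ∀ {n} (w : Word n) a b → Unique (rightOf w a b)
rightOf-unique {n} w a b = Uₚ.filter⁺ (rightOf? w a b) (Uₚ.allFin⁺ n)

invSeq≤ : ∀ {n} (w : Word n) i → invSeq w i ≤ toℕ i
invSeq≤ w i = subst₂ _≤_ (Lₚ.length-map toℕ (rightOf w i i)) (Lₚ.length-upTo (toℕ i))
  (unique-⊆⇒length≤ (Uₚ.map⁺ Fₚ.toℕ-injective (rightOf-unique w i i)) below)
  where
  below : map toℕ (rightOf w i i) ⊆ upTo (toℕ i)
  below k∈ with ∈-map⁻ toℕ k∈
  ... | j , j∈ , refl = ∈-upTo⁺ (proj₁ (∈-rightOf⁻ w j∈))

-- Whatever is right of `b` is also right of `a`, and `b` itself is counted in addition.
right⇒length< : ∀ {n} (w : Word n) {a b} → toℕ b < toℕ a → posOf w a < posOf w b →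
                length (rightOf w a b) < length (rightOf w a a)
right⇒length< w {a} {b} b<a a≺b = unique-⊆⇒length≤
  (All.tabulate (λ j∈ → λ { refl → ℕₚ.<-irrefl refl (proj₂ (∈-rightOf⁻ w j∈)) }) ∷ rightOf-unique w a b)
  λ { (here refl) → ∈-rightOf⁺ w b<a a≺b
    ; (there j∈) → let j<a , b≺j = ∈-rightOf⁻ w j∈ in ∈-rightOf⁺ w j<a (ℕₚ.<-trans a≺b b≺j) }

-- If `b` were not right of `a`, everything counted for `a` would be counted for `b`.
length<⇒right : ∀ {n} (w : Word n) {a b} →
                length (rightOf w a b) < length (rightOf w a a) → posOf w a < posOf w b
length<⇒right w {a} {b} lt = ℕₚ.≰⇒> λ b≼a → ℕₚ.<⇒≱ lt (unique-⊆⇒length≤ (rightOf-unique w a a)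
  λ j∈ → let j<a , a≺j = ∈-rightOf⁻ w j∈ in ∈-rightOf⁺ w j<a (ℕₚ.≤-<-trans b≼a a≺j))

-- The relative order of the values below `m`, in one direction; the induction on `m` carries both
-- directions along.
SameOrder : ∀ {n} → ℕ → Word n → Word n → Set
SameOrder m v w = ∀ a b → toℕ a < m → toℕ b < m → posOf v a < posOf v b → posOf w a < posOf w b

-- `b` and all the values counted lie below `a`, so the order of those values decides the count.
rightOf-sameOrder : ∀ {n} {v w : Word n} {a b} → SameOrder (toℕ a) v w → SameOrder (toℕ a) w v →
                    toℕ b < toℕ a → length (rightOf v a b) ≡ length (rightOf w a b)
rightOf-sameOrder {v = v} {w} {a} {b} vw wv b<a =
  unique-⊆⊇⇒length≡ (rightOf-unique v a b) (rightOf-unique w a b)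
    (λ j∈ → let j<a , b≺j = ∈-rightOf⁻ v j∈ in ∈-rightOf⁺ w j<a (vw b _ b<a j<a b≺j))
    (λ j∈ → let j<a , b≺j = ∈-rightOf⁻ w j∈ in ∈-rightOf⁺ v j<a (wv b _ b<a j<a b≺j))

-- The position of the value m among the smaller ones is decided by comparing
-- the number of smaller values right of b with the m-th entry of the inversion sequence.
sameOrder-step : ∀ {n m} {v w : Word n} → IsPerm v → IsPerm w → (∀ i → invSeq v i ≡ invSeq w i) →
                 SameOrder m v w → SameOrder m w v → SameOrder (suc m) v w
sameOrder-step {m = m} {v} {w} pv pw eq vw wv a b (s≤s a≤m) (s≤s b≤m) a≺b
  with toℕ a ℕ.≟ m | toℕ b ℕ.≟ m
... | no a≢m | no b≢m = vw a b (ℕₚ.≤∧≢⇒< a≤m a≢m) (ℕₚ.≤∧≢⇒< b≤m b≢m) a≺b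
... | yes a≡m | yes b≡m = contradiction
  (subst (λ b → posOf v a < posOf v b) (Fₚ.toℕ-injective (trans b≡m (sym a≡m))) a≺b) (ℕₚ.<-irrefl refl)
... | yes refl | no b≢m = length<⇒right w
  (subst₂ _<_ (rightOf-sameOrder {v = v} {w} vw wv b<m) (eq a) (right⇒length< v b<m a≺b))
  where b<m = ℕₚ.≤∧≢⇒< b≤m b≢m
-- The criterion needs the largest value on the left. Here it is on the right, so the opposite order
-- in `w` is carried back to `v` and refuted there.
... | no a≢m | yes refl with ℕₚ.<-cmp (posOf w a) (posOf w b)
...   | tri< a≺′b _ _ = a≺′b
...   | tri≈ _ same _ = contradiction (cong toℕ (posOf-injective w pw same)) a≢m
...   | tri> _ _ b≺′a = contradiction a≺b (ℕₚ.<⇒≯ (length<⇒right v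
  (subst₂ _<_ (sym (rightOf-sameOrder {v = v} {w} vw wv a<m)) (sym (eq b)) (right⇒length< w a<m b≺′a))))
  where a<m = ℕₚ.≤∧≢⇒< a≤m a≢m

sameOrder : ∀ {n} {v w : Word n} → IsPerm v → IsPerm w → (∀ i → invSeq v i ≡ invSeq w i) →
            ∀ m → SameOrder m v w × SameOrder m w v
sameOrder pv pw eq zero = (λ _ _ ()) , (λ _ _ ())
sameOrder {v = v} {w} pv pw eq (suc m) with sameOrder {v = v} {w} pv pw eq m
... | vw , wv = sameOrder-step {v = v} {w} pv pw eq vw wv , sameOrder-step {v = w} {v} pw pv (sym ∘ eq) wv vw

-- Sending a position in `v` to the position of the same value in `w` is strictly increasing, so it
-- never falls below the identity. With `v` and `w` exchanged as well, the positions agree.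
sameOrder⇒posOf≤ : ∀ {n} {v w : Word n} → IsPerm v → SameOrder n v w → ∀ a → posOf v a ≤ posOf w a
sameOrder⇒posOf≤ {v = v} {w} pv vw a with perm-surjective v pv a
... | p , refl = subst (_≤ posOf w (lookup v p)) (sym (posOf-lookup v pv p))
  (strictMono⇒≤ (posOf w ∘ lookup v) (λ {q} {r} q<r → vw _ _ (Fₚ.toℕ<n _) (Fₚ.toℕ<n _)
    (subst₂ _<_ (sym (posOf-lookup v pv q)) (sym (posOf-lookup v pv r)) q<r)) p)

invSeq-injective : ∀ {n} {v w : Word n} → IsPerm v → IsPerm w →
                   (∀ i → invSeq v i ≡ invSeq w i) → v ≡ w
invSeq-injective {n} {v} {w} pv pw eq with sameOrder {v = v} {w} pv pw eq n
... | vw , wv = lookup-injective λ p → posOf-injective w pw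
  (trans (ℕₚ.≤-antisym (sameOrder⇒posOf≤ {v = w} {v} pw wv _) (sameOrder⇒posOf≤ {v = v} {w} pv vw _))
    (trans (posOf-lookup v pv p) (sym (posOf-lookup w pw p))))

-- Codes of permutations

entry : ∀ {n} → Code n → Fin n → ℕ
entry (x ∷ c) zero = toℕ x
entry (x ∷ c) (suc i) = entry c i

entry-injective : ∀ {n} {c d : Code n} → (∀ i → entry c i ≡ entry d i) → c ≡ d
entry-injective {c = []} {[]} eq = refl
entry-injective {c = x ∷ c} {y ∷ d} eq =
  cong₂ _∷_ (Fₚ.toℕ-injective (eq zero)) (entry-injective (eq ∘ suc))

entry≤ : ∀ {n} (c : Code n) i → entry c i ≤ n ∸ suc (toℕ i)
entry≤ (x ∷ c) zero = ℕₚ.≤-pred (Fₚ.toℕ<n x)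
entry≤ (x ∷ c) (suc i) = entry≤ c i

fromEntries : ∀ {n} (f : Fin n → ℕ) → (∀ i → f i ≤ n ∸ suc (toℕ i)) → Code n
fromEntries {zero} f f≤ = []
fromEntries {suc n} f f≤ = F.fromℕ< (s≤s (f≤ zero)) ∷ fromEntries (f ∘ suc) (f≤ ∘ suc)

entry-fromEntries : ∀ {n} (f : Fin n → ℕ) f≤ i → entry (fromEntries f f≤) i ≡ f i
entry-fromEntries f f≤ zero = Fₚ.toℕ-fromℕ< _
entry-fromEntries f f≤ (suc i) = entry-fromEntries (f ∘ suc) (f≤ ∘ suc) i

-- A code begins with the entry of the largest value, so the inversion sequence is read backwards;
-- the bound `toℕ` of the reversed index is n - 1 - i.
encode : ∀ {n} → Word n → Code n
encode {n} w = fromEntries (invSeq w ∘ F.opposite)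
  λ i → subst (invSeq w (F.opposite i) ≤_) (Fₚ.opposite-prop i) (invSeq≤ w (F.opposite i))

entry-encode : ∀ {n} (w : Word n) i → entry (encode w) i ≡ invSeq w (F.opposite i)
entry-encode w = entry-fromEntries _ _

entry-encode-opposite : ∀ {n} (w : Word n) i → entry (encode w) (F.opposite i) ≡ invSeq w i
entry-encode-opposite w i = trans (entry-encode w _) (cong (invSeq w) (Fₚ.opposite-involutive i))

encode-injective : ∀ {n} {v w : Word n} → IsPerm v → IsPerm w → encode v ≡ encode w → v ≡ w
encode-injective {v = v} {w} pv pw eq = invSeq-injective pv pw λ i →
  trans (sym (entry-encode-opposite v i))
    (trans (cong (λ c → entry c (F.opposite i)) eq) (entry-encode-opposite w i))

-- Bijections by counting

perms : ∀ n → List (Word n)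
perms n = filter isPerm? (allWords n n)

perms-unique : ∀ n → Unique (perms n)
perms-unique n = Uₚ.filter⁺ isPerm? (allWords-unique n n)

∈-perms⁺ : ∀ {n} {w : Word n} → IsPerm w → w ∈ perms n
∈-perms⁺ pw = ∈-filter⁺ isPerm? (allWords-complete _ _ _) pw

∈-perms⁻ : ∀ {n} {w : Word n} → w ∈ perms n → IsPerm w
∈-perms⁻ {n} w∈ = proj₂ (∈-filter⁻ isPerm? {xs = allWords n n} w∈)

-- Injectivity is asked of members only, because `encode` is shown to be injective just on
-- permutations.
map-unique-on : ∀ {f : A → B} {xs} → (∀ {x y} → x ∈ xs → y ∈ xs → f x ≡ f y → x ≡ y) →
                Unique xs → Unique (map f xs)
map-unique-on {xs = []} inj [] = []
map-unique-on {f = f} {xs = x ∷ xs} inj u@(_ ∷ u′) =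
  All.tabulate (λ y∈ eq → case ∈-map⁻ f y∈ of λ { (x′ , x′∈ , e) →
    Uₚ.Unique[x∷xs]⇒x∉xs u (subst (_∈ xs) (sym (inj (here refl) (there x′∈) (trans eq e))) x′∈) })
  ∷ map-unique-on (λ p q → inj (there p) (there q)) u′

-- Both cyclePerm : codes → permutations and encode : permutations → codes are injective,
-- so by counting both are bijective.
cyclePerms-unique : ∀ n → Unique (map cyclePerm (allCodes n))
cyclePerms-unique n = Uₚ.map⁺ cyclePerm-injective (allCodes-unique n)

encodings-unique : ∀ n → Unique (map encode (perms n))
encodings-unique n =
  map-unique-on (λ p q → encode-injective (∈-perms⁻ p) (∈-perms⁻ q)) (perms-unique n)

cyclePerms⊆perms : ∀ {n} → map cyclePerm (allCodes n) ⊆ perms n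
cyclePerms⊆perms w∈ with ∈-map⁻ cyclePerm w∈
... | c , _ , refl = ∈-perms⁺ (cyclePerm-perm c)

length-codes≤perms : ∀ n → length (allCodes n) ≤ length (perms n)
length-codes≤perms n = subst (_≤ length (perms n)) (Lₚ.length-map cyclePerm (allCodes n))
  (unique-⊆⇒length≤ (cyclePerms-unique n) cyclePerms⊆perms)

length-perms≤codes : ∀ n → length (perms n) ≤ length (allCodes n)
length-perms≤codes n = subst (_≤ length (allCodes n)) (Lₚ.length-map encode (perms n))
  (unique-⊆⇒length≤ (encodings-unique n) (λ _ → allCodes-complete _))

cyclePerm-surjective : ∀ {n} {w : Word n} → IsPerm w → ∃[ c ] cyclePerm c ≡ w
cyclePerm-surjective {n} pw with ∈-map⁻ cyclePerm (unique-⊆-length≥⇒⊇ (cyclePerms-unique n) cyclePerms⊆perms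
    (subst (length (perms n) ≤_) (sym (Lₚ.length-map cyclePerm (allCodes n))) (length-perms≤codes n)) (∈-perms⁺ pw))
... | c , _ , eq = c , sym eq

abstract
  -- The preimage is found in `map encode (perms n)` and comes with no formula; later arguments use
  -- only that it is a permutation with code `c`.
  encode-surjective : ∀ {n} (c : Code n) → ∃[ w ] IsPerm w × encode w ≡ c
  encode-surjective {n} c with ∈-map⁻ encode (unique-⊆-length≥⇒⊇ {ys = allCodes n} (encodings-unique n)
      (λ _ → allCodes-complete _)
      (subst (length (allCodes n) ≤_) (sym (Lₚ.length-map encode (perms n))) (length-codes≤perms n))
      (allCodes-complete c))
  ... | w , w∈ , eq = w , ∈-perms⁻ w∈ , sym eq

decode : ∀ {n} → Code n → Word n
decode c = proj₁ (encode-surjective c)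

decode-perm : ∀ {n} (c : Code n) → IsPerm (decode c)
decode-perm c = proj₁ (proj₂ (encode-surjective c))

encode-decode : ∀ {n} (c : Code n) → encode (decode c) ≡ c
encode-decode c = proj₂ (proj₂ (encode-surjective c))

decode-encode : ∀ {n} {w : Word n} → IsPerm w → decode (encode w) ≡ w
decode-encode {w = w} pw = encode-injective (decode-perm _) pw (encode-decode (encode w))

-- `cyclePerm` matches the two sets, as cycles and nonzero entries add up to n. The bound on `i`
-- keeps the truncated subtraction exact.
c≡nonzeros-count : ∀ n i → i ≤ n → c n (n ∸ i) ≡ length (filter (λ d → nonzeros d ℕ.≟ i) (allCodes n))
c≡nonzeros-count n i i≤n = trans
  (unique-⊆⊇⇒length≡ (Uₚ.filter⁺ P? (allWords-unique n n))
    (Uₚ.map⁺ cyclePerm-injective (Uₚ.filter⁺ Q? (allCodes-unique n))) to from)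
  (Lₚ.length-map cyclePerm (filter Q? (allCodes n)))
  where
  P? : ∀ w → Dec (IsPerm w × cycles w ≡ n ∸ i)
  P? w = isPerm? w ×-dec (cycles w ℕ.≟ (n ∸ i))
  Q? : ∀ (d : Code n) → Dec (nonzeros d ≡ i)
  Q? d = nonzeros d ℕ.≟ i
  to : filter P? (allWords n n) ⊆ map cyclePerm (filter Q? (allCodes n))
  to {w} w∈ with ∈-filter⁻ P? {xs = allWords n n} w∈
  ... | _ , pw , eq with cyclePerm-surjective {w = w} pw
  ...   | d , refl = ∈-map⁺ cyclePerm (∈-filter⁺ Q? (allCodes-complete d)
    (ℕₚ.+-cancelˡ-≡ (n ∸ i) _ _ (trans (cong (_+ nonzeros d) (sym eq))
      (trans (cycles+nonzeros d) (sym (ℕₚ.m∸n+n≡m i≤n))))))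
  from : map cyclePerm (filter Q? (allCodes n)) ⊆ filter P? (allWords n n)
  from w∈ with ∈-map⁻ cyclePerm w∈
  ... | d , d∈ , refl with ∈-filter⁻ Q? {xs = allCodes n} d∈
  ...   | _ , refl = ∈-filter⁺ P? (allWords-complete n n _)
    (cyclePerm-perm d , trans (sym (ℕₚ.m+n∸n≡m _ (nonzeros d)))
      (cong (_∸ nonzeros d) (cycles+nonzeros d)))

-- Boolean intervals in the order of codes

_≼_ : ∀ {n} → Code n → Code n → Set
c ≼ d = ∀ i → entry c i ≤ entry d i

-- The index is at once the rank of the interval from the first code to the second and the dimension
-- of its boolean algebra.
data Lowering : ∀ {n} → ℕ → Code n → Code n → Set where
  done : Lowering 0 [] []
  keep : ∀ {n k} {c d : Code n} x → Lowering k c d → Lowering k (x ∷ c) (x ∷ d)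
  drop : ∀ {n k} {c d : Code n} (y : Fin n) → Lowering k c d → Lowering (suc k) (inject₁ y ∷ c) (suc y ∷ d)

lowering : ∀ {n} {c d : Code n} → c ≼ d → (∀ i → entry d i ≤ suc (entry c i)) → ∃[ k ] Lowering k c d
lowering {c = []} {[]} c≼d d≤1+c = 0 , done
lowering {c = x ∷ c} {y ∷ d} c≼d d≤1+c with lowering {c = c} {d} (c≼d ∘ suc) (d≤1+c ∘ suc) | x F.≟ y
... | k , l | yes refl = k , keep x l
lowering {c = x ∷ c} {zero ∷ d} c≼d d≤1+c | k , l | no x≢0 =
  contradiction (Fₚ.toℕ-injective (ℕₚ.n≤0⇒n≡0 (c≼d zero))) x≢0
lowering {c = x ∷ c} {suc y ∷ d} c≼d d≤1+c | k , l | no x≢y =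
  suc k , subst (λ x → Lowering (suc k) (x ∷ c) (suc y ∷ d)) (sym x≡y) (drop y l)
  where
  x≡y : x ≡ inject₁ y
  -- As `x` is at most `suc y` and different from it, `x` is at most `y`; the bound on `d` gives the
  -- converse.
  x≡y = Fₚ.toℕ-injective (trans
    (ℕₚ.≤-antisym (ℕₚ.≤-pred (ℕₚ.≤∧≢⇒< (c≼d zero) (x≢y ∘ Fₚ.toℕ-injective))) (ℕₚ.≤-pred (d≤1+c zero)))
    (sym (Fₚ.toℕ-inject₁ y)))

lowering⇒≼ : ∀ {n k} {c d : Code n} → Lowering k c d → c ≼ d
lowering⇒≼ (keep x l) zero = ℕₚ.≤-refl
lowering⇒≼ (keep x l) (suc i) = lowering⇒≼ l i
lowering⇒≼ (drop y l) zero = ℕₚ.≤-trans (ℕₚ.≤-reflexive (Fₚ.toℕ-inject₁ y)) (ℕₚ.n≤1+n _)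
lowering⇒≼ (drop y l) (suc i) = lowering⇒≼ l i

-- Only lowered coordinates get a bit, and it records the upper value. Codes outside the interval
-- are mapped too, hence the bounds on `e` in `from-to`.
toSubset : ∀ {n k} {c d : Code n} → Lowering k c d → Code n → Subset k
toSubset done [] = []
toSubset (keep x l) (z ∷ e) = toSubset l e
toSubset (drop y l) (z ∷ e) = does (z F.≟ suc y) ∷ toSubset l e

fromSubset : ∀ {n k} {c d : Code n} → Lowering k c d → Subset k → Code n
fromSubset done s = []
fromSubset (keep x l) s = x ∷ fromSubset l s
fromSubset (drop y l) (true ∷ s) = suc y ∷ fromSubset l s
fromSubset (drop y l) (false ∷ s) = inject₁ y ∷ fromSubset l s

to-from : ∀ {n k} {c d : Code n} (l : Lowering k c d) s → toSubset l (fromSubset l s) ≡ s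
to-from done [] = refl
to-from (keep x l) s = to-from l s
to-from (drop y l) (true ∷ s) = cong₂ _∷_ (dec-true (suc y F.≟ suc y) refl) (to-from l s)
to-from (drop y l) (false ∷ s) = cong₂ _∷_
  (dec-false (inject₁ y F.≟ suc y) λ eq → ℕₚ.1+n≢n (trans (sym (cong toℕ eq)) (Fₚ.toℕ-inject₁ y)))
  (to-from l s)

from-to : ∀ {n k} {c d e : Code n} (l : Lowering k c d) → c ≼ e → e ≼ d → fromSubset l (toSubset l e) ≡ e
from-to {e = []} done c≼e e≼d = refl
from-to {e = z ∷ e} (keep x l) c≼e e≼d = cong₂ _∷_
  (Fₚ.toℕ-injective (ℕₚ.≤-antisym (c≼e zero) (e≼d zero))) (from-to l (c≼e ∘ suc) (e≼d ∘ suc))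
from-to {e = z ∷ e} (drop y l) c≼e e≼d with z F.≟ suc y
... | yes refl = cong (suc y ∷_) (from-to l (c≼e ∘ suc) (e≼d ∘ suc))
... | no z≢ = cong₂ _∷_
  (Fₚ.toℕ-injective (ℕₚ.≤-antisym (c≼e zero) (subst (toℕ z ≤_) (sym (Fₚ.toℕ-inject₁ y))
    (ℕₚ.≤-pred (ℕₚ.≤∧≢⇒< (e≼d zero) (z≢ ∘ Fₚ.toℕ-injective))))))
  (from-to l (c≼e ∘ suc) (e≼d ∘ suc))

≼-from : ∀ {n k} {c d : Code n} (l : Lowering k c d) s → c ≼ fromSubset l s
≼-from (keep x l) s zero = ℕₚ.≤-refl
≼-from (keep x l) s (suc i) = ≼-from l s i
≼-from l@(drop y _) (true ∷ s) zero = lowering⇒≼ l zero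
≼-from (drop y l) (true ∷ s) (suc i) = ≼-from l s i
≼-from (drop y l) (false ∷ s) zero = ℕₚ.≤-refl
≼-from (drop y l) (false ∷ s) (suc i) = ≼-from l s i

from-≼ : ∀ {n k} {c d : Code n} (l : Lowering k c d) s → fromSubset l s ≼ d
from-≼ (keep x l) s zero = ℕₚ.≤-refl
from-≼ (keep x l) s (suc i) = from-≼ l s i
from-≼ (drop y l) (true ∷ s) zero = ℕₚ.≤-refl
from-≼ (drop y l) (true ∷ s) (suc i) = from-≼ l s i
from-≼ l@(drop y _) (false ∷ s) zero = lowering⇒≼ l zero
from-≼ (drop y l) (false ∷ s) (suc i) = from-≼ l s i

from-mono : ∀ {n k} {c d : Code n} (l : Lowering k c d) {s t} → s S.⊆ t → fromSubset l s ≼ fromSubset l t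
from-mono (keep x l) s⊆t zero = ℕₚ.≤-refl
from-mono (keep x l) s⊆t (suc i) = from-mono l s⊆t i
from-mono (drop y l) {true ∷ s} {true ∷ t} s⊆t zero = ℕₚ.≤-refl
from-mono l@(drop y _) {false ∷ s} {t} s⊆t zero = ≼-from l t zero
from-mono (drop y l) {true ∷ s} {true ∷ t} s⊆t (suc i) = from-mono l (Sₚ.drop-∷-⊆ s⊆t) i
from-mono (drop y l) {true ∷ s} {false ∷ t} s⊆t i = case s⊆t V.here of λ ()
from-mono (drop y l) {false ∷ s} {true ∷ t} s⊆t (suc i) = from-mono l (Sₚ.drop-∷-⊆ s⊆t) i
from-mono (drop y l) {false ∷ s} {false ∷ t} s⊆t (suc i) = from-mono l (Sₚ.drop-∷-⊆ s⊆t) i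

to-mono : ∀ {n k} {c d e e′ : Code n} (l : Lowering k c d) → e ≼ e′ → e′ ≼ d → toSubset l e S.⊆ toSubset l e′
to-mono {e = []} {[]} done e≼e′ e′≼d = id
to-mono {e = _ ∷ _} {_ ∷ _} (keep x l) e≼e′ e′≼d = to-mono l (e≼e′ ∘ suc) (e′≼d ∘ suc)
to-mono {e = z ∷ e} {z′ ∷ e′} (drop y l) e≼e′ e′≼d with z F.≟ suc y | z′ F.≟ suc y
... | no _ | _ = Sₚ.out⊆ (to-mono l (e≼e′ ∘ suc) (e′≼d ∘ suc))
... | yes _ | yes _ = Sₚ.in⊆in (to-mono l (e≼e′ ∘ suc) (e′≼d ∘ suc))
-- `z` already has the upper value, and `z′` lies between `z` and that value.
... | yes refl | no z′≢ = contradiction (Fₚ.toℕ-injective (ℕₚ.≤-antisym (e′≼d zero) (e≼e′ zero))) z′≢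

-- Transport from codes to the middle order

encode-mono : ∀ {n} {v w : Word n} → v ≤ₘ w → encode v ≼ encode w
encode-mono {v = v} {w} v≤w i =
  subst₂ _≤_ (sym (entry-encode v i)) (sym (entry-encode w i)) (v≤w (F.opposite i))

encode-reflect : ∀ {n} {v w : Word n} → encode v ≼ encode w → v ≤ₘ w
encode-reflect {v = v} {w} v≼w i =
  subst₂ _≤_ (entry-encode-opposite v i) (entry-encode-opposite w i) (v≼w (F.opposite i))

total : ∀ {n} → Code n → ℕ
total [] = 0
total (x ∷ c) = toℕ x + total c

total-lowering : ∀ {n k} {c d : Code n} → Lowering k c d → k + total c ≡ total d
total-lowering done = refl
total-lowering {k = k} (keep {c = c} x l) = trans (sym (ℕₚ.+-assoc k (toℕ x) _))
  (trans (cong (_+ total c) (ℕₚ.+-comm k (toℕ x)))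
    (trans (ℕₚ.+-assoc (toℕ x) k _) (cong (toℕ x +_) (total-lowering l))))
total-lowering {k = suc k} (drop {c = c} y l) = cong suc (trans
  (cong (λ m → k + (m + total c)) (Fₚ.toℕ-inject₁ y))
  (trans (sym (ℕₚ.+-assoc k (toℕ y) _)) (trans (cong (_+ total c) (ℕₚ.+-comm k (toℕ y)))
    (trans (ℕₚ.+-assoc (toℕ y) k _) (cong (toℕ y +_) (total-lowering l))))))

total-entries : ∀ {n} (c : Code n) → sum (tabulate (entry c)) ≡ total c
total-entries [] = refl
total-entries (x ∷ c) = cong (toℕ x +_) (total-entries c)

-- `F.opposite zero` is the last index, so splitting off the last term is the recursion step for
-- reversing a sum.
sum-tabulate-last : ∀ {n} (f : Fin (suc n) → ℕ) →
                    sum (tabulate f) ≡ f (fromℕ n) + sum (tabulate (f ∘ inject₁))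
sum-tabulate-last {zero} f = refl
sum-tabulate-last {suc n} f = begin
  f zero + sum (tabulate (f ∘ suc))
    ≡⟨ cong (f zero +_) (sum-tabulate-last (f ∘ suc)) ⟩
  f zero + (f (fromℕ (suc n)) + rest)
    ≡⟨ ℕₚ.+-assoc (f zero) _ rest ⟨
  f zero + f (fromℕ (suc n)) + rest
    ≡⟨ cong (_+ rest) (ℕₚ.+-comm (f zero) _) ⟩
  f (fromℕ (suc n)) + f zero + rest
    ≡⟨ ℕₚ.+-assoc _ (f zero) rest ⟩
  f (fromℕ (suc n)) + (f zero + rest) ∎
  where
  open ≡-Reasoning
  rest = sum (tabulate (f ∘ suc ∘ inject₁))

sum-tabulate-opposite : ∀ {n} (f : Fin n → ℕ) → sum (tabulate (f ∘ F.opposite)) ≡ sum (tabulate f)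
sum-tabulate-opposite {zero} f = refl
sum-tabulate-opposite {suc n} f = trans
  (cong (f (fromℕ n) +_) (sum-tabulate-opposite (f ∘ inject₁))) (sym (sum-tabulate-last f))

rank≡total : ∀ {n} (w : Word n) → rank w ≡ total (encode w)
rank≡total w = begin
  sum (map (invSeq w) (allFin _))        ≡⟨ cong sum (Lₚ.map-tabulate id (invSeq w)) ⟩
  sum (tabulate (invSeq w))              ≡⟨ sum-tabulate-opposite (invSeq w) ⟨
  sum (tabulate (invSeq w ∘ F.opposite)) ≡⟨ cong sum (Lₚ.tabulate-cong (entry-encode w)) ⟨
  sum (tabulate (entry (encode w)))      ≡⟨ total-entries (encode w) ⟩
  total (encode w)                       ∎
  where open ≡-Reasoning

rank-lowering : ∀ {n k} {v w : Word n} → Lowering k (encode v) (encode w) → rank w ∸ rank v ≡ k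
rank-lowering {k = k} {v} {w} l = trans
  (cong₂ _∸_ (trans (rank≡total w) (sym (total-lowering l))) (rank≡total v)) (ℕₚ.m+n∸n≡m k (total (encode v)))

-- `encode` identifies the interval with the codes between the two ends, and these correspond to the
-- subsets of the `k` lowered coordinates.
lowering⇒boolean : ∀ {n k} {v w : Word n} → Lowering k (encode v) (encode w) → IsoToBoolean v w k
lowering⇒boolean {n} {k} {v} {w} l = to , from , from∘to , to∘from , λ x y → mk⇔ (mono x y) (reflect x y)
  where
  to : Interval v w → Subset k
  to (u , _) = toSubset l (encode u)

  from : Subset k → Interval v w
  from s = u , decode-perm e ,
    encode-reflect {v = v} {u} (λ i → subst (entry (encode v) i ≤_) (at i) (≼-from l s i)) ,
    encode-reflect {v = u} {w} (λ i → subst (_≤ entry (encode w) i) (at i) (from-≼ l s i))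
    where
    e = fromSubset l s
    u = decode e
    at : ∀ i → entry e i ≡ entry (encode u) i
    at i = cong (λ c → entry c i) (sym (encode-decode e))

  from-to-encode : ∀ x → fromSubset l (to x) ≡ encode (proj₁ x)
  from-to-encode (u , _ , v≤u , u≤w) = from-to l (encode-mono {v = v} {u} v≤u) (encode-mono {v = u} {w} u≤w)

  from∘to : ∀ x → proj₁ (from (to x)) ≡ proj₁ x
  from∘to x@(u , pu , _) = trans (cong decode (from-to-encode x)) (decode-encode pu)

  to∘from : ∀ s → to (from s) ≡ s
  to∘from s = trans (cong (toSubset l) (encode-decode (fromSubset l s))) (to-from l s)

  mono : ∀ x y → proj₁ x ≤ₘ proj₁ y → to x S.⊆ to y
  mono (u , _) (u′ , _ , _ , u′≤w) u≤u′ =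
    to-mono l (encode-mono {v = u} {u′} u≤u′) (encode-mono {v = u′} {w} u′≤w)

  reflect : ∀ x y → to x S.⊆ to y → proj₁ x ≤ₘ proj₁ y
  reflect x y x⊆y = encode-reflect {v = proj₁ x} {proj₁ y}
    (subst₂ _≼_ (from-to-encode x) (from-to-encode y) (from-mono l x⊆y))

-- Entries across a boolean interval grow by at most one

realize : ∀ {n} (f : Fin n → ℕ) → (∀ i → f i ≤ toℕ i) →
          ∃[ u ] IsPerm u × (∀ i → invSeq u i ≡ f i)
realize {n} f f≤ = decode e , decode-perm e , λ i → begin
  invSeq (decode e) i                        ≡⟨ entry-encode-opposite (decode e) i ⟨
  entry (encode (decode e)) (F.opposite i)   ≡⟨ cong (λ c → entry c (F.opposite i)) (encode-decode e) ⟩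
  entry e (F.opposite i)                     ≡⟨ entry-fromEntries _ _ (F.opposite i) ⟩
  f (F.opposite (F.opposite i))              ≡⟨ cong f (Fₚ.opposite-involutive i) ⟩
  f i                                        ∎
  where
  open ≡-Reasoning
  e : Code n
  e = fromEntries (f ∘ F.opposite) λ i → subst (f (F.opposite i) ≤_) (Fₚ.opposite-prop i) (f≤ (F.opposite i))

module _ {n m} {v w : Word n} (v≤w : v ≤ₘ w) (iso : IsoToBoolean v w m) (i : Fin n) where
  private
    f = proj₁ iso
    g = proj₁ (proj₂ iso)
    fg = proj₁ (proj₂ (proj₂ (proj₂ iso)))

    f-mono : ∀ x y → proj₁ x ≤ₘ proj₁ y → f x S.⊆ f y
    f-mono x y = Equivalence.to (proj₂ (proj₂ (proj₂ (proj₂ iso))) x y)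

    f-reflect : ∀ x y → f x S.⊆ f y → proj₁ x ≤ₘ proj₁ y
    f-reflect x y = Equivalence.from (proj₂ (proj₂ (proj₂ (proj₂ iso))) x y)

    AgreesOff : Word n → Set
    AgreesOff u = ∀ j → j ≢ i → invSeq u j ≡ invSeq v j

    -- Elements that agree with `v` off entry `i` are ordered by a single number, so they form a
    -- chain.
    ≤ₘ-from-entry : ∀ u u′ → AgreesOff u → AgreesOff u′ → invSeq u i ≤ invSeq u′ i → u ≤ₘ u′
    ≤ₘ-from-entry u u′ off off′ le j with j F.≟ i
    ... | yes refl = le
    ... | no j≢i = ℕₚ.≤-reflexive (trans (off j j≢i) (sym (off′ j j≢i)))

    At : ℕ → Set
    At t = Σ (Interval v w) λ x → AgreesOff (proj₁ x) × invSeq (proj₁ x) i ≡ t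

    between : ∀ t → invSeq v i ≤ t → t ≤ invSeq w i →
              At t
    between t vᵢ≤t t≤wᵢ = (u , pu , lower , upper) , off , on
      where
      h : Fin n → ℕ
      h j with j F.≟ i
      ... | yes _ = t
      ... | no _ = invSeq v j

      h-on : h i ≡ t
      h-on with i F.≟ i
      ... | yes _ = refl
      ... | no i≢i = contradiction refl i≢i

      h-off : ∀ j → j ≢ i → h j ≡ invSeq v j
      h-off j j≢i with j F.≟ i
      ... | yes j≡i = contradiction j≡i j≢i
      ... | no _ = refl

      v≤h : ∀ j → invSeq v j ≤ h j
      v≤h j with j F.≟ i
      ... | yes refl = vᵢ≤t
      ... | no _ = ℕₚ.≤-refl

      h≤w : ∀ j → h j ≤ invSeq w j
      h≤w j with j F.≟ i
      ... | yes refl = t≤wᵢ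
      ... | no _ = v≤w j

      -- `h` is an admissible inversion sequence because it stays below that of `w`.
      realized = realize h (λ j → ℕₚ.≤-trans (h≤w j) (invSeq≤ w j))
      u = proj₁ realized
      pu = proj₁ (proj₂ realized)
      eq = proj₂ (proj₂ realized)
      lower : v ≤ₘ u
      lower j = subst (invSeq v j ≤_) (sym (eq j)) (v≤h j)
      upper : u ≤ₘ w
      upper j = subst (_≤ invSeq w j) (sym (eq j)) (h≤w j)
      off : AgreesOff u
      off j j≢i = trans (eq j) (h-off j j≢i)
      on : invSeq u i ≡ t
      on = trans (eq i) h-on

    -- The relative complement `e` of `b` lies between `a` and `d`, hence in the chain, and is
    -- comparable with `b`. If `e` is below `b`, then so is `d`; if `b` is below `e`, then `b` is
    -- below `a`. The entries at `i` exclude both.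
    gap⇒⊥ : ¬ invSeq w i ≤ suc (invSeq v i) →
            At (invSeq v i) → At (suc (invSeq v i)) → At (invSeq w i) → ⊥
    gap⇒⊥ ¬le (a , a-off , aᵢ) (b , b-off , bᵢ) (d , d-off , dᵢ)
      = case ℕₚ.≤-total (invSeq (proj₁ e) i) (invSeq (proj₁ b) i) of
          λ { (inj₁ e≤b) → e≰b e≤b ; (inj₂ b≤e) → b≰e b≤e }
      where
      -- the complement of f b relative to [f a, f d]
      s = f a ∪ (f d ∩ ∁ (f b))
      e = g s

      fa⊆s : f a S.⊆ s
      fa⊆s = Sₚ.p⊆p∪q _

      fa⊆fd : f a S.⊆ f d
      fa⊆fd = f-mono a d (≤ₘ-from-entry (proj₁ a) (proj₁ d) a-off d-off (subst₂ _≤_ (sym aᵢ) (sym dᵢ) (v≤w i)))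

      s⊆fd : s S.⊆ f d
      s⊆fd x∈ with Sₚ.x∈p∪q⁻ (f a) _ x∈
      ... | inj₁ x∈fa = fa⊆fd x∈fa
      ... | inj₂ x∈ = proj₁ (Sₚ.x∈p∩q⁻ (f d) _ x∈)

      a≤e : proj₁ a ≤ₘ proj₁ e
      a≤e = f-reflect a e (λ x∈ → subst (_ S.∈_) (sym (fg s)) (fa⊆s x∈))

      e≤d : proj₁ e ≤ₘ proj₁ d
      e≤d = f-reflect e d (λ x∈ → s⊆fd (subst (_ S.∈_) (fg s) x∈))

      e-off : AgreesOff (proj₁ e)
      -- Off entry `i` the ends `a` and `d` both agree with `v`, which squeezes `e`.
      e-off j j≢i = ℕₚ.≤-antisym 
        (subst (invSeq (proj₁ e) j ≤_) (d-off j j≢i) (e≤d j))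
        (subst (_≤ invSeq (proj₁ e) j) (a-off j j≢i) (a≤e j))

      e≰b : ¬ invSeq (proj₁ e) i ≤ invSeq (proj₁ b) i
      e≰b le = ¬le (subst₂ _≤_ dᵢ bᵢ (f-reflect d b fd⊆fb i))
        where
        s⊆fb : s S.⊆ f b
        s⊆fb x∈ = f-mono e b (≤ₘ-from-entry (proj₁ e) (proj₁ b) e-off b-off le) (subst (_ S.∈_) (sym (fg s)) x∈)
        fd⊆fb : f d S.⊆ f b
        fd⊆fb {x} x∈ with x Sₚ.∈? f b
        ... | yes x∈fb = x∈fb
        ... | no x∉fb = s⊆fb (Sₚ.q⊆p∪q (f a) _ (Sₚ.x∈p∩q⁺ (x∈ , Sₚ.x∉p⇒x∈∁p x∉fb)))

      b≰e : ¬ invSeq (proj₁ b) i ≤ invSeq (proj₁ e) i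
      b≰e le = ℕₚ.<⇒≱ (ℕₚ.n<1+n _) (subst₂ _≤_ bᵢ aᵢ (f-reflect b a fb⊆fa i))
        where
        fb⊆s : f b S.⊆ s
        fb⊆s x∈ = subst (_ S.∈_) (fg s) (f-mono b e (≤ₘ-from-entry (proj₁ b) (proj₁ e) b-off e-off le) x∈)
        fb⊆fa : f b S.⊆ f a
        fb⊆fa x∈ with Sₚ.x∈p∪q⁻ (f a) _ (fb⊆s x∈)
        ... | inj₁ x∈fa = x∈fa
        ... | inj₂ x∈d∖b = contradiction x∈ (Sₚ.x∈∁p⇒x∉p (proj₂ (Sₚ.x∈p∩q⁻ (f d) _ x∈d∖b)))

  boolean⇒entry≤1+ : invSeq w i ≤ suc (invSeq v i)
  -- The middle point has entry one above that of `v`, and the assumed gap leaves it strictly below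
  -- that of `w`.
  boolean⇒entry≤1+ = ℕₚ.≮⇒≥ λ gap → gap⇒⊥ (ℕₚ.<⇒≱ gap)
    (between (invSeq v i) ℕₚ.≤-refl (v≤w i))
    (between (suc (invSeq v i)) (ℕₚ.n≤1+n _) (ℕₚ.<⇒≤ gap))
    (between (invSeq w i) (v≤w i) ℕₚ.≤-refl)

boolean⇒lowering : ∀ {n k} {v w : Word n} → IsBooleanIntervalOfRank k v w → Lowering k (encode v) (encode w)
boolean⇒lowering {n} {k} {v} {w} (_ , _ , v≤w , (_ , iso) , rank≡k) =
  -- The entrywise bounds yield some number of lowered entries; it equals `k` because both are the
  -- difference of ranks.
  subst (λ k → Lowering k (encode v) (encode w)) (trans (sym (rank-lowering {v = v} {w} (proj₂ l))) rank≡k) (proj₂ l)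
  where
  bound : ∀ i → entry (encode w) i ≤ suc (entry (encode v) i)
  bound i = begin
    entry (encode w) i             ≡⟨ entry-encode w i ⟩
    invSeq w (F.opposite i)        ≤⟨ boolean⇒entry≤1+ {v = v} {w} v≤w iso (F.opposite i) ⟩
    suc (invSeq v (F.opposite i))  ≡⟨ cong suc (entry-encode v i) ⟨
    suc (entry (encode v) i)       ∎
    where open ℕₚ.≤-Reasoning
  l : ∃[ k ] Lowering k (encode v) (encode w)
  l = lowering {c = encode v} {encode w} (encode-mono {v = v} {w} v≤w) bound

lowering⇒booleanInterval : ∀ {n k} {v w : Word n} → IsPerm v → IsPerm w → Lowering k (encode v) (encode w) →
                           IsBooleanIntervalOfRank k v w
lowering⇒booleanInterval {v = v} {w} pv pw l =
  pv , pw , encode-reflect {v = v} {w} (lowering⇒≼ l) , (_ , lowering⇒boolean {v = v} {w} l) ,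
  rank-lowering {v = v} {w} l

-- Enumeration of the boolean intervals

lowerings : ∀ {n} → Code n → ℕ → List (Code n)
lowerings [] zero = [] ∷ []
lowerings [] (suc k) = []
lowerings (zero ∷ d) k = map (zero ∷_) (lowerings d k)
lowerings (suc y ∷ d) zero = map (suc y ∷_) (lowerings d zero)
lowerings (suc y ∷ d) (suc k) = map (suc y ∷_) (lowerings d (suc k)) ++ map (inject₁ y ∷_) (lowerings d k)

∈-lowerings⁺ : ∀ {n k} {c d : Code n} → Lowering k c d → c ∈ lowerings d k
∈-lowerings⁺ done = here refl
∈-lowerings⁺ (keep zero l) = ∈-map⁺ (zero ∷_) (∈-lowerings⁺ l)
∈-lowerings⁺ {k = zero} (keep (suc y) l) = ∈-map⁺ (suc y ∷_) (∈-lowerings⁺ l)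
∈-lowerings⁺ {k = suc k} (keep (suc y) l) = ∈-++⁺ˡ (∈-map⁺ (suc y ∷_) (∈-lowerings⁺ l))
∈-lowerings⁺ (drop {k = k} {d = d} y l) =
  ∈-++⁺ʳ (map (suc y ∷_) (lowerings d (suc k))) (∈-map⁺ (inject₁ y ∷_) (∈-lowerings⁺ l))

∈-lowerings⁻ : ∀ {n} k {c} (d : Code n) → c ∈ lowerings d k → Lowering k c d
∈-lowerings⁻ zero [] (here refl) = done
∈-lowerings⁻ k (zero ∷ d) c∈ with ∈-map⁻ (zero ∷_) c∈
... | c′ , c′∈ , refl = keep zero (∈-lowerings⁻ k d c′∈)
∈-lowerings⁻ zero (suc y ∷ d) c∈ with ∈-map⁻ (suc y ∷_) c∈
... | c′ , c′∈ , refl = keep (suc y) (∈-lowerings⁻ zero d c′∈)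
∈-lowerings⁻ (suc k) (suc y ∷ d) c∈ with ∈-++⁻ (map (suc y ∷_) (lowerings d (suc k))) c∈
... | inj₁ p with ∈-map⁻ (suc y ∷_) p
...   | c′ , c′∈ , refl = keep (suc y) (∈-lowerings⁻ (suc k) d c′∈)
∈-lowerings⁻ (suc k) (suc y ∷ d) c∈ | inj₂ p with ∈-map⁻ (inject₁ y ∷_) p
... | c′ , c′∈ , refl = drop y (∈-lowerings⁻ k d c′∈)

suc≢inject₁ : ∀ {n} (y : Fin n) → suc y ≢ inject₁ y
suc≢inject₁ y eq = ℕₚ.1+n≢n (trans (cong toℕ eq) (Fₚ.toℕ-inject₁ y))

lowerings-unique : ∀ {n} k (d : Code n) → Unique (lowerings d k)
lowerings-unique zero [] = [] ∷ []
lowerings-unique (suc k) [] = []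
lowerings-unique k (zero ∷ d) = Uₚ.map⁺ ∷-injʳ (lowerings-unique k d)
lowerings-unique zero (suc y ∷ d) = Uₚ.map⁺ ∷-injʳ (lowerings-unique zero d)
lowerings-unique (suc k) (suc y ∷ d) =
  Uₚ.++⁺ (Uₚ.map⁺ ∷-injʳ (lowerings-unique (suc k) d)) (Uₚ.map⁺ ∷-injʳ (lowerings-unique k d))
    λ { (p , q) → case ∈-map⁻ _ p , ∈-map⁻ _ q of λ { ((_ , _ , refl) , (_ , _ , eq)) →
      suc≢inject₁ y (∷-injˡ eq) } }

-- A zero cannot be lowered. Keeping or lowering the first nonzero entry gives the two terms of
-- Pascal's rule.
length-lowerings : ∀ {n} k (d : Code n) → length (lowerings d k) ≡ nonzeros d C k
length-lowerings zero [] = refl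
length-lowerings (suc k) [] = refl
length-lowerings k (zero ∷ d) = trans (Lₚ.length-map _ (lowerings d k)) (length-lowerings k d)
length-lowerings zero (suc y ∷ d) = trans (Lₚ.length-map _ (lowerings d zero)) (length-lowerings zero d)
length-lowerings (suc k) (suc y ∷ d) = begin
  length (map (suc y ∷_) (lowerings d (suc k)) ++ map (inject₁ y ∷_) (lowerings d k))
    ≡⟨ Lₚ.length-++ (map (suc y ∷_) (lowerings d (suc k))) ⟩
  length (map (suc y ∷_) (lowerings d (suc k))) + length (map (inject₁ y ∷_) (lowerings d k))
    ≡⟨ cong₂ _+_ (Lₚ.length-map _ (lowerings d (suc k))) (Lₚ.length-map _ (lowerings d k)) ⟩
  length (lowerings d (suc k)) + length (lowerings d k)
    ≡⟨ cong₂ _+_ (length-lowerings (suc k) d) (length-lowerings k d) ⟩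
  nonzeros d C suc k + nonzeros d C k
    ≡⟨ ℕₚ.+-comm (nonzeros d C suc k) _ ⟩
  nonzeros d C k + nonzeros d C suc k
    ≡⟨ nCk+nC[k+1]≡[n+1]C[k+1] (nonzeros d) k ⟩
  suc (nonzeros d) C suc k ∎
  where open ≡-Reasoning

-- Summation over the number of nonzero entries

sum-bump : ∀ {F G : ℕ → ℕ} {a k is} → Unique is → k ∈ is → G k ≡ a + F k →
           (∀ {i} → i ≢ k → G i ≡ F i) → sum (map G is) ≡ a + sum (map F is)
sum-bump {F} {G} {a} {k} {i ∷ is} u (here refl) at off = trans
  (cong₂ _+_ at (cong sum (Lₚ.map-cong-local {xs = is}
    (All.tabulate λ {j} j∈ → off {j} λ { refl → Uₚ.Unique[x∷xs]⇒x∉xs u j∈ }))))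
  (ℕₚ.+-assoc a (F k) _)
sum-bump {F} {G} {a} {k} {i ∷ is} u@(_ ∷ u′) (there k∈) at off = begin
  G i + sum (map G is)        ≡⟨ cong₂ _+_ (off λ { refl → Uₚ.Unique[x∷xs]⇒x∉xs u k∈ }) (sum-bump u′ k∈ at off) ⟩
  F i + (a + sum (map F is))  ≡⟨ ℕₚ.+-assoc (F i) a _ ⟨
  F i + a + sum (map F is)    ≡⟨ cong (_+ sum (map F is)) (ℕₚ.+-comm (F i) a) ⟩
  a + F i + sum (map F is)    ≡⟨ ℕₚ.+-assoc a (F i) _ ⟩
  a + (F i + sum (map F is))  ∎
  where open ≡-Reasoning

-- Adding `x` to the list enlarges only the fibre over `h x`, so by `sum-bump` the right side grows
-- by `g (h x)`, just as the left side does.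
sum-by-value : ∀ (h : A → ℕ) (g : ℕ → ℕ) N xs → (∀ x → h x < N) →
               sum (map (g ∘ h) xs) ≡ sum (map (λ i → g i * length (filter (λ x → h x ℕ.≟ i) xs)) (upTo N))
sum-by-value h g N [] h<N = sym (zeros (upTo N))
  where
  zeros : ∀ is → sum (map (λ i → g i * 0) is) ≡ 0
  zeros [] = refl
  zeros (i ∷ is) = cong₂ _+_ (ℕₚ.*-zeroʳ (g i)) (zeros is)
sum-by-value h g N (x ∷ xs) h<N = trans (cong (g (h x) +_) (sum-by-value h g N xs h<N))
  (sym (sum-bump (Uₚ.upTo⁺ N) (∈-upTo⁺ (h<N x))
    (trans (cong (λ ys → g (h x) * length ys) (Lₚ.filter-accept (λ y → h y ℕ.≟ h x) refl)) (ℕₚ.*-suc (g (h x)) _))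
    λ {i} i≢ → cong (λ ys → g i * length ys) (Lₚ.filter-reject (λ y → h y ℕ.≟ i) (i≢ ∘ sym))))

length-concatMap : ∀ (f : A → List B) xs → length (concatMap f xs) ≡ sum (map (length ∘ f) xs)
length-concatMap f [] = refl
length-concatMap f (x ∷ xs) = trans (Lₚ.length-++ (f x)) (cong (length (f x) +_) (length-concatMap f xs))

-- The intervals are grouped by their top, which therefore tells the blocks of `booleanIntervals`
-- apart.
intervalsBelow : ∀ {n} → ℕ → Code n → List (Word n × Word n)
intervalsBelow k d = map (λ c → decode c , decode d) (lowerings d k)

booleanIntervals : ∀ n → ℕ → List (Word n × Word n)
booleanIntervals n k = concatMap (intervalsBelow k) (allCodes n)

decode-injective : ∀ {n} {c d : Code n} → decode c ≡ decode d → c ≡ d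
decode-injective {c = c} {d} eq = trans (sym (encode-decode c)) (trans (cong encode eq) (encode-decode d))

booleanIntervals-unique : ∀ n k → Unique (booleanIntervals n k)
booleanIntervals-unique n k = concatMap-unique (allCodes-unique n)
  (λ d → Uₚ.map⁺ (decode-injective ∘ cong proj₁) (lowerings-unique k d))
  λ p q → case ∈-map⁻ _ p , ∈-map⁻ _ q of λ { ((_ , _ , refl) , (_ , _ , eq)) → decode-injective (cong proj₂ eq) }

∈-booleanIntervals⁻ : ∀ {n k} {v w : Word n} → (v , w) ∈ booleanIntervals n k → IsBooleanIntervalOfRank k v w
∈-booleanIntervals⁻ {n} {k} vw∈ with concatMap-∈⁻ {f = intervalsBelow k} (allCodes n) vw∈
... | d , _ , vw∈d with ∈-map⁻ _ vw∈d
...   | c , c∈ , refl = lowering⇒booleanInterval (decode-perm c) (decode-perm d)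
  (subst₂ (Lowering k) (sym (encode-decode c)) (sym (encode-decode d)) (∈-lowerings⁻ k d c∈))

∈-booleanIntervals⁺ : ∀ {n k} {v w : Word n} → IsBooleanIntervalOfRank k v w → (v , w) ∈ booleanIntervals n k
∈-booleanIntervals⁺ {n} {k} {v} {w} b@(pv , pw , _) =
  subst₂ (λ v w → (v , w) ∈ booleanIntervals n k) (decode-encode pv) (decode-encode pw)
    (concatMap-∈⁺ {f = intervalsBelow k} (allCodes-complete (encode w))
      (∈-map⁺ (λ c → decode c , decode (encode w)) (∈-lowerings⁺ (boolean⇒lowering {v = v} {w} b))))

length-booleanIntervals : ∀ n k → length (booleanIntervals n k) ≡ rhs n k
length-booleanIntervals n k = begin
  length (booleanIntervals n k)
    ≡⟨ length-concatMap (intervalsBelow k) (allCodes n) ⟩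
  sum (map (length ∘ intervalsBelow k) (allCodes n))
    ≡⟨ cong sum (Lₚ.map-cong (λ d → trans (Lₚ.length-map _ (lowerings d k)) (length-lowerings k d)) (allCodes n)) ⟩
  sum (map (λ d → nonzeros d C k) (allCodes n))
    -- At most n entries are nonzero, so the possible values 0, ..., n are exactly the range of the
    -- sum in `rhs`.
    ≡⟨ sum-by-value nonzeros (_C k) (suc n) (allCodes n) (s≤s ∘ nonzeros≤) ⟩
  sum (map (λ i → (i C k) * length (filter (λ d → nonzeros d ℕ.≟ i) (allCodes n))) (upTo (suc n)))
    ≡⟨ cong sum (Lₚ.map-cong-local (All.tabulate λ {i} i∈ →
         cong ((i C k) *_) (sym (c≡nonzeros-count n i (ℕₚ.≤-pred (∈-upTo⁻ i∈)))))) ⟩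
  rhs n k ∎
  where open ≡-Reasoning

theorem3p8 : ∀ (n k : ℕ) → k < n → NumBooleanIntervals n k (rhs n k)
theorem3p8 n k _ = booleanIntervals n k , booleanIntervals-unique n k ,
  (λ v w → mk⇔ ∈-booleanIntervals⁻ ∈-booleanIntervals⁺) , length-booleanIntervals n k
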